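{- Let $G$ be a connected bridgeless cubic graph such that the Petersen graph $P$ admits a $G$-coloring. Then $G$ is isomorphic to $P$.
   Context: Graphs are finite, undirected, without loops, possibly with multiple edges. For a vertex $v$ of a graph $G$, $\partial_G(v)$ denotes the set of edges incident to $v$. For cubic graphs $G$ and $H$, an $H$-coloring of $G$ is a map $f\colon E(G)\to E(H)$ which is a proper edge-coloring (adjacent edges of $G$ receive distinct edges of $H$) such that for every vertex $x$ of $G$ there is a vertex $y$ of $H$ with $f(\partial_G(x))=\partial_H(y)$; the paper writes $H\prec G$ when $G$ admits an $H$-coloring, so the hypothesis is $G\prec P$. The Petersen graph $P$ is the cubic graph on 10 vertices $u_1,\dots,u_5,v_1,\dots,v_5$ with edges $u_iu_{i+1}$, $u_iv_i$, $v_iv_{i+2}$ (indices mod 5). -}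

module Defs where

open import Data.Nat using (ℕ)
open import Data.Fin using (Fin; zero; suc; #_)
open import Data.Product using (Σ; _×_; _,_; ∃; ∃-syntax)
open import Data.Sum using (_⊎_)
open import Data.Unit using (⊤)
open import Relation.Nullary using (¬_)
open import Relation.Binary.PropositionalEquality using (_≡_; _≢_)
open import Function.Bundles using (_↔_)

record Graph : Set where
  field
    V E : ℕ
    end₁ end₂ : Fin E → Fin V
    noLoop : ∀ e → end₁ e ≢ end₂ e

open Graph public

Inc : (G : Graph) → Fin (E G) → Fin (V G) → Set
Inc G e v = (end₁ G e ≡ v) ⊎ (end₂ G e ≡ v)

-- cubic: every vertex has exactly three incident edges
-- (no loops, so degree = number of incident edges)
Cubic : Graph → Set
Cubic G = ∀ v → Σ (Fin (E G)) λ e₁ → Σ (Fin (E G)) λ e₂ → Σ (Fin (E G)) λ e₃ →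
  (e₁ ≢ e₂) × (e₁ ≢ e₃) × (e₂ ≢ e₃) ×
  Inc G e₁ v × Inc G e₂ v × Inc G e₃ v ×
  (∀ e → Inc G e v → (e ≡ e₁) ⊎ (e ≡ e₂) ⊎ (e ≡ e₃))

data Reach (G : Graph) (ok : Fin (E G) → Set) (u : Fin (V G)) : Fin (V G) → Set where
  here  : Reach G ok u u
  step₁ : ∀ e → ok e → Reach G ok u (end₁ G e) → Reach G ok u (end₂ G e)
  step₂ : ∀ e → ok e → Reach G ok u (end₂ G e) → Reach G ok u (end₁ G e)

Connected : Graph → Set
Connected G = ∀ u v → Reach G (λ _ → ⊤) u v

IsBridge : (G : Graph) → Fin (E G) → Set
IsBridge G e = ¬ Reach G (λ e′ → e′ ≢ e) (end₁ G e) (end₂ G e)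

-- no edge is a bridge (stated positively; reachability is decidable on finite graphs)
Bridgeless : Graph → Set
Bridgeless G = ∀ e → Reach G (λ e′ → e′ ≢ e) (end₁ G e) (end₂ G e)

IsHColoring : (H G : Graph) → (Fin (E G) → Fin (E H)) → Set
IsHColoring H G f =
  (∀ e e′ x → e ≢ e′ → Inc G e x → Inc G e′ x → f e ≢ f e′) ×
  (∀ x → ∃[ y ] ((∀ e → Inc G e x → Inc H (f e) y) ×
                 (∀ d → Inc H d y → ∃[ e ] (Inc G e x × f e ≡ d))))

HColorable : (H G : Graph) → Set
HColorable H G = ∃[ f ] IsHColoring H G f

record Iso (G H : Graph) : Set where
  field
    vmap : Fin (V G) ↔ Fin (V H)
    emap : Fin (E G) ↔ Fin (E H)
  open Function.Bundles.Inverse vmap renaming (to to φ)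
  open Function.Bundles.Inverse emap renaming (to to ψ)
  field
    preserves : ∀ e →
      ((φ (end₁ G e) ≡ end₁ H (ψ e)) × (φ (end₂ G e) ≡ end₂ H (ψ e))) ⊎
      ((φ (end₁ G e) ≡ end₂ H (ψ e)) × (φ (end₂ G e) ≡ end₁ H (ψ e)))

-- Petersen graph: u_i = i, v_i = 5 + i (i = 0..4);
-- edges 0..4: u_i u_(i+1); 5..9: u_i v_i; 10..14: v_i v_(i+2).
pEnd₁ pEnd₂ : Fin 15 → Fin 10
pEnd₁ (zero) = # 0
pEnd₁ (suc (zero)) = # 1
pEnd₁ (suc (suc (zero))) = # 2
pEnd₁ (suc (suc (suc (zero)))) = # 3
pEnd₁ (suc (suc (suc (suc (zero))))) = # 4
pEnd₁ (suc (suc (suc (suc (suc (zero)))))) = # 0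
pEnd₁ (suc (suc (suc (suc (suc (suc (zero))))))) = # 1
pEnd₁ (suc (suc (suc (suc (suc (suc (suc (zero)))))))) = # 2
pEnd₁ (suc (suc (suc (suc (suc (suc (suc (suc (zero))))))))) = # 3
pEnd₁ (suc (suc (suc (suc (suc (suc (suc (suc (suc (zero)))))))))) = # 4
pEnd₁ (suc (suc (suc (suc (suc (suc (suc (suc (suc (suc (zero))))))))))) = # 5
pEnd₁ (suc (suc (suc (suc (suc (suc (suc (suc (suc (suc (suc (zero)))))))))))) = # 6
pEnd₁ (suc (suc (suc (suc (suc (suc (suc (suc (suc (suc (suc (suc (zero))))))))))))) = # 7
pEnd₁ (suc (suc (suc (suc (suc (suc (suc (suc (suc (suc (suc (suc (suc (zero)))))))))))))) = # 8
pEnd₁ (suc (suc (suc (suc (suc (suc (suc (suc (suc (suc (suc (suc (suc (suc (zero))))))))))))))) = # 9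
pEnd₂ (zero) = # 1
pEnd₂ (suc (zero)) = # 2
pEnd₂ (suc (suc (zero))) = # 3
pEnd₂ (suc (suc (suc (zero)))) = # 4
pEnd₂ (suc (suc (suc (suc (zero))))) = # 0
pEnd₂ (suc (suc (suc (suc (suc (zero)))))) = # 5
pEnd₂ (suc (suc (suc (suc (suc (suc (zero))))))) = # 6
pEnd₂ (suc (suc (suc (suc (suc (suc (suc (zero)))))))) = # 7
pEnd₂ (suc (suc (suc (suc (suc (suc (suc (suc (zero))))))))) = # 8
pEnd₂ (suc (suc (suc (suc (suc (suc (suc (suc (suc (zero)))))))))) = # 9
pEnd₂ (suc (suc (suc (suc (suc (suc (suc (suc (suc (suc (zero))))))))))) = # 7
pEnd₂ (suc (suc (suc (suc (suc (suc (suc (suc (suc (suc (suc (zero)))))))))))) = # 8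
pEnd₂ (suc (suc (suc (suc (suc (suc (suc (suc (suc (suc (suc (suc (zero))))))))))))) = # 9
pEnd₂ (suc (suc (suc (suc (suc (suc (suc (suc (suc (suc (suc (suc (suc (zero)))))))))))))) = # 5
pEnd₂ (suc (suc (suc (suc (suc (suc (suc (suc (suc (suc (suc (suc (suc (suc (zero))))))))))))))) = # 6

pNoLoop : ∀ e → pEnd₁ e ≢ pEnd₂ e
pNoLoop (zero) ()
pNoLoop (suc (zero)) ()
pNoLoop (suc (suc (zero))) ()
pNoLoop (suc (suc (suc (zero)))) ()
pNoLoop (suc (suc (suc (suc (zero))))) ()
pNoLoop (suc (suc (suc (suc (suc (zero)))))) ()
pNoLoop (suc (suc (suc (suc (suc (suc (zero))))))) ()
pNoLoop (suc (suc (suc (suc (suc (suc (suc (zero)))))))) ()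
pNoLoop (suc (suc (suc (suc (suc (suc (suc (suc (zero))))))))) ()
pNoLoop (suc (suc (suc (suc (suc (suc (suc (suc (suc (zero)))))))))) ()
pNoLoop (suc (suc (suc (suc (suc (suc (suc (suc (suc (suc (zero))))))))))) ()
pNoLoop (suc (suc (suc (suc (suc (suc (suc (suc (suc (suc (suc (zero)))))))))))) ()
pNoLoop (suc (suc (suc (suc (suc (suc (suc (suc (suc (suc (suc (suc (zero))))))))))))) ()
pNoLoop (suc (suc (suc (suc (suc (suc (suc (suc (suc (suc (suc (suc (suc (zero)))))))))))))) ()
pNoLoop (suc (suc (suc (suc (suc (suc (suc (suc (suc (suc (suc (suc (suc (suc (zero))))))))))))))) ()

Petersen : Graph
Petersen = record { V = 10 ; E = 15 ; end₁ = pEnd₁ ; end₂ = pEnd₂ ; noLoop = pNoLoop }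

{-# OPTIONS --safe #-}

-- Let f be the colouring and g x a vertex of G whose star is the image of the star of x.  Up to
-- renaming of colours, f is a partition of the 15 edges of the Petersen graph in which every colour
-- lies in at most two different colour triples, since an edge of G has only two ends.  An exhaustive
-- search finds that such a partition is either discrete or has exactly one colour b lying in a single
-- triple; in the latter case the image of g can only be left through b, so b is a bridge.  Hence f is
-- injective, therefore so is g, and the image of g is closed under adjacency.
module Submission where

open import Defs
open import Data.Bool using (Bool; true; false; T; not; if_then_else_; _∧_; _∨_)
open import Data.Bool.ListAction using (all; any)
open import Data.Bool.Properties using (T-≡; T-∧; T-∨)
open import Data.Fin using (Fin; zero; suc; #_)
open import Data.Fin.Properties using (_≟_; suc-injective) renaming (all? to allFin?)
open import Data.List using (List; []; _∷_; allFin; length; mapMaybe) renaming (lookup to _‼_)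
open import Data.List.Membership.DecPropositional (_≟_ {15}) using (_∈?_)
open import Data.List.Membership.Propositional using (_∈_; _∉_; find)
open import Data.List.Membership.Propositional.Properties using (∈-allFin; ∈-lookup)
open import Data.List.Relation.Binary.Pointwise using (Pointwise; []; _∷_)
open import Data.List.Relation.Unary.All as All using (All; []; _∷_; all?)
open import Data.List.Relation.Unary.All.Properties using (all⁺; mapMaybe⁺)
  renaming (map⁺ to All-map⁺)
open import Data.List.Relation.Unary.Any as Any using (Any; here; there; any?)
open import Data.List.Relation.Unary.Any.Properties using (any⁺; any⁻; lookup-index)
open import Data.Maybe using (Maybe; just; nothing; maybe′; zipWith)
open import Data.Maybe.Properties using (just-injective)
open import Data.Maybe.Relation.Unary.All as Maybe using (just; nothing)
open import Data.Product using (_×_; _,_; ∃; ∃-syntax; proj₁; proj₂)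
open import Data.Sum using (_⊎_; inj₁; inj₂; [_,_]′)
open import Data.Vec using (Vec; []; _∷_; lookup; _[_]≔_; replicate)
open import Data.Vec.Properties using (lookup∘update; lookup∘update′; lookup-replicate)
open import Function using (_∘_; Injective; mk↔ₛ′; Equivalence)
open import Relation.Binary.PropositionalEquality using (_≡_; _≢_; refl; sym; trans; cong; subst)
open import Relation.Nullary using (¬_; Dec; yes; no; contradiction)
open import Relation.Nullary.Decidable
  using (⌊_⌋; toWitness; toWitnessFalse; fromWitness; _⊎-dec_; _→-dec_)

-- Stars and ends in the Petersen graph.

Edge Vertex : Set
Edge   = Fin 15
Vertex = Fin 10

-- The search computes with this table: filtering all edges for incidence would be much slower.
star : Vertex → List Edge
star = lookup
  ( (# 0 ∷ # 4  ∷ # 5  ∷ []) ∷ (# 0 ∷ # 1  ∷ # 6  ∷ []) ∷ (# 1 ∷ # 2  ∷ # 7  ∷ [])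
  ∷ (# 2 ∷ # 3  ∷ # 8  ∷ []) ∷ (# 3 ∷ # 4  ∷ # 9  ∷ []) ∷ (# 5 ∷ # 10 ∷ # 13 ∷ [])
  ∷ (# 6 ∷ # 11 ∷ # 14 ∷ []) ∷ (# 7 ∷ # 10 ∷ # 12 ∷ []) ∷ (# 8 ∷ # 11 ∷ # 13 ∷ [])
  ∷ (# 9 ∷ # 12 ∷ # 14 ∷ []) ∷ [])

ends : Edge → List Vertex
ends e = pEnd₁ e ∷ pEnd₂ e ∷ []

inc? : ∀ e x → Dec (Inc Petersen e x)
inc? e x = (pEnd₁ e ≟ x) ⊎-dec (pEnd₂ e ≟ x)

∈-star⁻ : ∀ {x e} → e ∈ star x → Inc Petersen e x
∈-star⁻ {x} = All.lookup
  (toWitness {a? = allFin? λ x → all? (λ e → inc? e x) (star x)} _ x)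

∈-star⁺ : ∀ {x e} → Inc Petersen e x → e ∈ star x
∈-star⁺ {x} {e} =
  toWitness {a? = allFin? λ x → allFin? λ e → inc? e x →-dec e ∈? star x} _ x e

-- Two different vertices share at most one edge, as there are no parallel edges, so no star
-- contains another; checked by evaluation.
star-injective : ∀ x y → All (_∈ star y) (star x) → x ≡ y
star-injective =
  toWitness {a? = allFin? λ x → allFin? λ y → all? (_∈? star y) (star x) →-dec x ≟ y} _

∈-ends⁻ : ∀ e {x} → x ∈ ends e → Inc Petersen e x
∈-ends⁻ e (here refl)         = inj₁ refl
∈-ends⁻ e (there (here refl)) = inj₂ refl

-- The search over partial colourings.

-- A colour is named by the first edge that received it; the palette lists the names in use.
Coloring Palette : Set
Coloring = Vec (Maybe Edge) 15
Palette  = List Edge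

assigned : Coloring → Edge → Edge → Bool
assigned p e c = maybe′ (λ d → ⌊ c ≟ d ⌋) false (lookup p e)

codes : Coloring → List Edge → Maybe Palette
codes p []       = just []
codes p (e ∷ es) = zipWith _∷_ (lookup p e) (codes p es)

triples : Coloring → List Vertex → List Palette
triples p = mapMaybe (codes p ∘ star)

apart : Palette → Palette → Bool
apart t u = any (λ c → not ⌊ c ∈? u ⌋) t

twice : Edge → List Palette → Bool
-- This reduces to `false`, so `twice⁻` has no case for the empty list.
twice c []      = ⌊ c ∈? [] ⌋
twice c (t ∷ D) = (⌊ c ∈? t ⌋ ∧ any (λ u → ⌊ c ∈? u ⌋) D) ∨ twice c D

clashing : Coloring → Edge → Edge → Edge → Bool
clashing p e c e′ = assigned p e′ c ∧ not ⌊ e ≟ e′ ⌋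

clash : Coloring → Edge → Edge → Bool
clash p e c = any (λ x → any (clashing p e c) (star x)) (ends e)

-- An edge cut of size one: `b` leaves the set of vertices listed in `D`, while every other colour
-- seen there has both its ends in the set.
bridge : List Palette → Edge → Bool
bridge D b = any (λ t → ⌊ b ∈? t ⌋) D ∧ not (twice b D)
  ∧ all (all (λ c → ⌊ c ≟ b ⌋ ∨ twice c D)) D

-- D lists the different triples met so far, which belong to different vertices of G.
handled : List Edge → Palette → Coloring → List Palette → Bool
visited : List Palette → List Edge → Palette → Coloring → List Palette → Bool

handled []       pal p D = all (λ e → assigned p e e) (allFin 15) ∨ any (bridge D) pal
handled (e ∷ es) pal p D =
  all (λ c → clash p e c ∨
             visited (triples (p [ e ]≔ just c) (ends e)) es pal (p [ e ]≔ just c) D) pal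
  ∧ visited (triples (p [ e ]≔ just e) (ends e)) es (e ∷ pal) (p [ e ]≔ just e) D

visited []       es pal p D = handled es pal p D
visited (t ∷ ts) es pal p D = if all (apart t) D
  then any (λ c → twice c D) t ∨ visited ts es pal p (t ∷ D)
  else visited ts es pal p D

-- An order in which triples are completed early keeps the search small (3672 nodes).
order : List Edge
order = # 0 ∷ # 4 ∷ # 5 ∷ # 1 ∷ # 6 ∷ # 7 ∷ # 2 ∷ # 10 ∷ # 12 ∷ # 13 ∷ # 8 ∷ # 3 ∷ # 9 ∷ # 14 ∷ # 11 ∷ []

-- The exhaustive case analysis is carried out here, by evaluation.
search : handled order [] (replicate 15 nothing) [] ≡ true
search = refl

-- Meaning of the Boolean tests.

T-∧⁻ : ∀ {a b} → T (a ∧ b) → T a × T b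
T-∧⁻ = Equivalence.to T-∧

T-∧⁺ : ∀ {a b} → T a × T b → T (a ∧ b)
T-∧⁺ = Equivalence.from T-∧

T-∨⁻ : ∀ {a b} → T (a ∨ b) → T a ⊎ T b
T-∨⁻ = Equivalence.to T-∨

T-∨⁺ : ∀ {a b} → T a ⊎ T b → T (a ∨ b)
T-∨⁺ = Equivalence.from T-∨

¬T-not : ∀ {b} → T (not b) → ¬ T b
¬T-not {false} _ ()

apart⁻ : ∀ t u → T (apart t u) → ∃[ c ] c ∈ t × c ∉ u
apart⁻ t u h with c , c∈t , c∉u ← find (any⁻ (λ c → not ⌊ c ∈? u ⌋) t h) =
  c , c∈t , toWitnessFalse c∉u

∈-index : ∀ {c : Edge} {D : List Palette} → Any (c ∈_) D → ∃[ i ] c ∈ (D ‼ i)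
∈-index w = Any.index w , lookup-index w

any-∈⁻ : ∀ c D → T (any (λ t → ⌊ c ∈? t ⌋) D) → ∃[ i ] c ∈ (D ‼ i)
any-∈⁻ c D h = ∈-index (Any.map toWitness (any⁻ (λ t → ⌊ c ∈? t ⌋) D h))

any-∈⁺ : ∀ c D {j} → c ∈ (D ‼ j) → T (any (λ t → ⌊ c ∈? t ⌋) D)
any-∈⁺ c D {j} c∈Dj = any⁺ (λ t → ⌊ c ∈? t ⌋)
  (Any.map (λ {t} eq → fromWitness {a? = c ∈? t} (subst (c ∈_) eq c∈Dj)) (∈-lookup {xs = D} j))

twice⁻ : ∀ c D → T (twice c D) → ∃[ i ] ∃[ j ] i ≢ j × c ∈ (D ‼ i) × c ∈ (D ‼ j)
twice⁻ c (t ∷ D) h with T-∨⁻ {⌊ c ∈? t ⌋ ∧ any (λ u → ⌊ c ∈? u ⌋) D} h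
... | inj₁ both with c∈t , rest ← T-∧⁻ {⌊ c ∈? t ⌋} both
                with j , c∈Dj ← any-∈⁻ c D rest =
  zero , suc j , (λ ()) , toWitness c∈t , c∈Dj
... | inj₂ later with i , j , i≢j , c∈Di , c∈Dj ← twice⁻ c D later =
  suc i , suc j , i≢j ∘ suc-injective , c∈Di , c∈Dj

twice⁺ : ∀ c D {i j} → i ≢ j → c ∈ (D ‼ i) → c ∈ (D ‼ j) → T (twice c D)
twice⁺ c (t ∷ D) {zero}  {zero}  i≢j _ _ = contradiction refl i≢j
twice⁺ c (t ∷ D) {zero}  {suc j} _ c∈t c∈Dj =
  T-∨⁺ {⌊ c ∈? t ⌋ ∧ any (λ u → ⌊ c ∈? u ⌋) D}
    (inj₁ (T-∧⁺ (fromWitness {a? = c ∈? t} c∈t , any-∈⁺ c D c∈Dj)))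
twice⁺ c (t ∷ D) {suc i} {zero}  i≢j c∈Di c∈t = twice⁺ c (t ∷ D) (i≢j ∘ sym) c∈t c∈Di
twice⁺ c (t ∷ D) {suc i} {suc j} i≢j c∈Di c∈Dj =
  T-∨⁺ {⌊ c ∈? t ⌋ ∧ any (λ u → ⌊ c ∈? u ⌋) D} (inj₂ (twice⁺ c D (i≢j ∘ cong suc) c∈Di c∈Dj))

twice-other : ∀ c D j → T (twice c D) → ∃[ k ] j ≢ k × c ∈ (D ‼ k)
twice-other c D j h with twice⁻ c D h
... | i , i′ , i≢i′ , c∈i , c∈i′ with j ≟ i
... | yes refl = i′ , i≢i′ , c∈i′
... | no  j≢i  = i , j≢i , c∈i

assigned⁻ : ∀ p {e c} → T (assigned p e c) → lookup p e ≡ just c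
assigned⁻ p {e} {c} h with lookup p e
... | just d = cong just (sym (toWitness {a? = c ≟ d} h))

clash⁻ : ∀ p e c → T (clash p e c) →
  ∃[ x ] ∃[ e′ ] Inc Petersen e x × Inc Petersen e′ x × lookup p e′ ≡ just c × e ≢ e′
clash⁻ p e c h
  with x , x∈ , hx ← find (any⁻ (λ x → any (clashing p e c) (star x)) (ends e) h)
  with e′ , e′∈ , he ← find (any⁻ (clashing p e c) (star x) hx)
  with eq , ne ← T-∧⁻ {assigned p e′ c} he =
  x , e′ , ∈-ends⁻ e x∈ , ∈-star⁻ e′∈ , assigned⁻ p eq , toWitnessFalse {a? = e ≟ e′} ne

codes-pointwise : ∀ p es {t} → codes p es ≡ just t →
  Pointwise (λ e c → lookup p e ≡ just c) es t
codes-pointwise p []       refl = []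
codes-pointwise p (e ∷ es) eq with lookup p e in eqₑ | codes p es in eqₛ
codes-pointwise p (e ∷ es) refl | just c | just t = eqₑ ∷ codes-pointwise p es eqₛ

-- Ends of edges and walks in an arbitrary graph.

module _ (G : Graph) where

  two-ends : ∀ {e u v w} → Inc G e u → Inc G e v → Inc G e w → u ≢ v → w ≡ u ⊎ w ≡ v
  two-ends (inj₁ refl) (inj₁ refl) _           u≢v = contradiction refl u≢v
  two-ends (inj₂ refl) (inj₂ refl) _           u≢v = contradiction refl u≢v
  two-ends (inj₁ refl) (inj₂ refl) (inj₁ refl) _   = inj₁ refl
  two-ends (inj₁ refl) (inj₂ refl) (inj₂ refl) _   = inj₂ refl
  two-ends (inj₂ refl) (inj₁ refl) (inj₁ refl) _   = inj₂ refl
  two-ends (inj₂ refl) (inj₁ refl) (inj₂ refl) _   = inj₁ refl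

  module _ {ok : Fin (E G) → Set} {Q : Fin (V G) → Set}
           (closed : ∀ {e u v} → ok e → Inc G e u → Inc G e v → Q u → Q v) where

    reach-closed : ∀ {u v} → Reach G ok u v → Q u → Q v
    reach-closed here           q = q
    reach-closed (step₁ e o r)  q = closed o (inj₁ refl) (inj₂ refl) (reach-closed r q)
    reach-closed (step₂ e o r)  q = closed o (inj₂ refl) (inj₁ refl) (reach-closed r q)

    -- Stands in for symmetry of `Reach`: `Bridgeless` gives walks from `end₁` to `end₂`, and
    -- `no-bridge` also has to follow them backwards.
    reach-closed⁻ : ∀ {u v} → Reach G ok u v → Q v → Q u
    reach-closed⁻ here          q = q
    reach-closed⁻ (step₁ e o r) q = reach-closed⁻ r (closed o (inj₂ refl) (inj₁ refl) q)
    reach-closed⁻ (step₂ e o r) q = reach-closed⁻ r (closed o (inj₁ refl) (inj₂ refl) q)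

-- Search states interpreted in `G`.

module Colored (G : Graph) (f : Edge → Fin (E G)) (g : Vertex → Fin (V G))
  (proper : ∀ e e′ x → e ≢ e′ → Inc Petersen e x → Inc Petersen e′ x → f e ≢ f e′)
  (f-inc : ∀ {x e} → Inc Petersen e x → Inc G (f e) (g x))
  (f-lift : ∀ {x d} → Inc G d (g x) → ∃[ e ] (Inc Petersen e x × f e ≡ d))
  where

  InjectiveOn : Palette → Set
  InjectiveOn pal = ∀ {c d} → c ∈ pal → d ∈ pal → f c ≡ f d → c ≡ d

  Agrees : Palette → Coloring → Set
  Agrees pal p = ∀ e {c} → lookup p e ≡ just c → c ∈ pal × f c ≡ f e

  record Represents (pal t : Palette) (v : Fin (V G)) : Set where
    field
      inPalette : ∀ {c} → c ∈ t → c ∈ pal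
      sound     : ∀ {c} → c ∈ t → Inc G (f c) v
      complete  : ∀ {d} → Inc G d v → ∃[ c ] c ∈ t × f c ≡ d

    hit : InjectiveOn pal → ∀ {c} → c ∈ pal → Inc G (f c) v → c ∈ t
    hit inj c∈ i with c′ , c′∈t , eq ← complete i =
      subst (_∈ t) (inj (inPalette c′∈t) c∈ eq) c′∈t

  open Represents

  -- Because `at` is injective, a colour in two triples of `D` has both its ends among the located
  -- vertices.
  record Located (pal : Palette) (D : List Palette) : Set where
    field
      at           : Fin (length D) → Fin (V G)
      represents   : ∀ i → Represents pal (D ‼ i) (at i)
      at-injective : ∀ {i j} → at i ≡ at j → i ≡ j

  open Located

  assign : ∀ {pal} p {e c} → Agrees pal p → c ∈ pal → f c ≡ f e → Agrees pal (p [ e ]≔ just c)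
  assign p {e} {c} agr c∈ eq e′ h with e′ ≟ e
  ... | yes refl with refl ← just-injective (trans (sym (lookup∘update e p (just c))) h) = c∈ , eq
  ... | no  e′≢e = agr e′ (trans (sym (lookup∘update′ e′≢e p (just c))) h)

  fresh-agrees : ∀ {pal} p e → Agrees pal p → Agrees (e ∷ pal) p
  fresh-agrees p e agr e′ h with c∈ , eq ← agr e′ h = there c∈ , eq

  fresh-injective : ∀ {pal e} → InjectiveOn pal → ¬ Any (λ c → f c ≡ f e) pal →
    InjectiveOn (e ∷ pal)
  fresh-injective inj new (here refl) (here refl) _  = refl
  fresh-injective inj new (here refl) (there d∈)  eq =
    contradiction (Any.map (λ { refl → sym eq }) d∈) new
  fresh-injective inj new (there c∈)  (here refl) eq =
    contradiction (Any.map (λ { refl → eq }) c∈) new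
  fresh-injective inj new (there c∈)  (there d∈)  eq = inj c∈ d∈ eq

  fresh-located : ∀ {pal D} e → Located pal D → Located (e ∷ pal) D
  fresh-located e loc = record
    { at           = at loc
    ; represents   = λ i → let r = represents loc i in record
        { inPalette = there ∘ inPalette r ; sound = sound r ; complete = complete r }
    ; at-injective = at-injective loc
    }

  -- `f` maps the star of `x` onto the star of `g x`, so the names of the colours on the first star
  -- describe the second.
  codes-represent : ∀ {pal p} → Agrees pal p → ∀ x {t} → codes p (star x) ≡ just t →
    Represents pal t (g x)
  codes-represent {pal} {p} agr x {t} eq = record
    { inPalette = λ c∈ → proj₁ (back c∈)
    ; sound     = λ c∈ → let _ , e , e∈ , fc≡fe = back c∈ in
                  subst (λ d → Inc G d (g x)) (sym fc≡fe) (f-inc (∈-star⁻ e∈))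
    ; complete  = λ i → let e , ie , fe≡d = f-lift i
                            c , c∈ , fc≡fe = forth pw (∈-star⁺ ie)
                        in c , c∈ , trans fc≡fe fe≡d
    }
    where
    pw : Pointwise (λ e c → lookup p e ≡ just c) (star x) t
    pw = codes-pointwise p (star x) eq

    back′ : ∀ {es t c} → Pointwise (λ e c → lookup p e ≡ just c) es t → c ∈ t →
      c ∈ pal × ∃[ e ] e ∈ es × f c ≡ f e
    back′ (h ∷ hs) (here refl) with c∈ , fc≡fe ← agr _ h = c∈ , _ , here refl , fc≡fe
    back′ (h ∷ hs) (there c∈t) with c∈ , e , e∈ , fc≡fe ← back′ hs c∈t = c∈ , e , there e∈ , fc≡fe

    back : ∀ {c} → c ∈ t → c ∈ pal × ∃[ e ] e ∈ star x × f c ≡ f e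
    back = back′ pw

    forth : ∀ {es t e} → Pointwise (λ e c → lookup p e ≡ just c) es t → e ∈ es →
      ∃[ c ] c ∈ t × f c ≡ f e
    forth (h ∷ hs) (here refl) = _ , here refl , proj₂ (agr _ h)
    forth (h ∷ hs) (there e∈) with c , c∈ , eq ← forth hs e∈ = c , there c∈ , eq

  triples-represent : ∀ {pal p} → Agrees pal p → ∀ xs →
    All (∃ ∘ Represents pal) (triples p xs)
  triples-represent {pal} {p} agr xs = mapMaybe⁺ (All-map⁺ (All.universal represent xs))
    where
    represent : ∀ x → Maybe.All (∃ ∘ Represents pal) (codes p (star x))
    represent x with codes p (star x) in eq
    ... | nothing = nothing
    ... | just t  = just (g x , codes-represent agr x eq)

  -- Testing one inclusion suffices: if `v` were the vertex of an earlier triple, that triple would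
  -- contain every palette colour at `v`, by `hit`, and hence all of `t`.
  locate : ∀ {pal D t v} → InjectiveOn pal → Located pal D → Represents pal t v →
    T (all (apart t) D) → Located pal (t ∷ D)
  locate {pal} {D} {t} {v} inj loc r h = record
    { at = at′ ; represents = represents′ ; at-injective = λ {i} {j} → at-injective′ i j }
    where
    at′ : Fin (length (t ∷ D)) → Fin (V G)
    at′ zero    = v
    at′ (suc i) = at loc i

    represents′ : ∀ i → Represents pal ((t ∷ D) ‼ i) (at′ i)
    represents′ zero    = r
    represents′ (suc i) = represents loc i

    v≢at : ∀ i → v ≢ at loc i
    v≢at i eq with c , c∈t , c∉ ← apart⁻ t (D ‼ i) (All.lookup (all⁺ (apart t) D h) (∈-lookup i)) =
      c∉ (hit (represents loc i) inj (inPalette r c∈t) (subst (Inc G (f c)) eq (sound r c∈t)))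

    at-injective′ : ∀ i j → at′ i ≡ at′ j → i ≡ j
    at-injective′ zero    zero    _  = refl
    at-injective′ zero    (suc j) eq = contradiction eq (v≢at j)
    at-injective′ (suc i) zero    eq = contradiction (sym eq) (v≢at i)
    at-injective′ (suc i) (suc j) eq = cong suc (at-injective loc eq)

  -- A colour of `t` that is already in two triples of `D` would be an edge of `G` with three
  -- different ends.
  not-crowded : ∀ {pal D t} → Located pal (t ∷ D) → ¬ T (any (λ c → twice c D) t)
  not-crowded {D = D} {t} loc h
    with c , c∈t , tw ← find (any⁻ (λ c → twice c D) t h)
    with i , j , i≢j , c∈i , c∈j ← twice⁻ c D tw
    with two-ends G (sound (represents loc (suc i)) c∈i) (sound (represents loc (suc j)) c∈j)
                  (sound (represents loc zero) c∈t) (i≢j ∘ suc-injective ∘ at-injective loc)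
  ... | inj₁ eq with () ← at-injective loc eq
  ... | inj₂ eq with () ← at-injective loc eq

  -- A walk between the ends of `f b` that avoids `f b` never leaves the located vertices, so both
  -- ends are located. Only one located vertex lies on `f b`, so `f b` would be a loop.
  no-bridge : ∀ {pal D} → Bridgeless G → InjectiveOn pal → Located pal D → ∀ b → ¬ T (bridge D b)
  no-bridge {pal} {D} bridgeless inj loc b h
    with b∈D , h′ ← T-∧⁻ {any (λ t → ⌊ b ∈? t ⌋) D} h
    with once , others ← T-∧⁻ {not (twice b D)} h′
    with i , b∈Di ← any-∈⁻ b D b∈D = [ from₁ , from₂ ]′ (sound (represents loc i) b∈Di)
    where
    Seen : Fin (V G) → Set
    Seen u = ∃[ j ] at loc j ≡ u

    closed : ∀ {d u w} → d ≢ f b → Inc G d u → Inc G d w → Seen u → Seen w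
    closed d≢ iu iw (j , refl)
      with c , c∈ , refl ← complete (represents loc j) iu
      with T-∨⁻ {⌊ c ≟ b ⌋} (All.lookup (all⁺ _ (D ‼ j) (All.lookup (all⁺ _ D others) (∈-lookup j))) c∈)
    ... | inj₁ c≡b = contradiction (cong f (toWitness c≡b)) d≢
    -- The second triple containing `c` supplies the other end of the edge, so the walk moves to
    -- `at loc j` or `at loc k`.
    ... | inj₂ tw with k , j≢k , c∈k ← twice-other c D j tw
                  with two-ends G iu (sound (represents loc k) c∈k) iw (j≢k ∘ at-injective loc)
    ...   | inj₁ eq = j , sym eq
    ...   | inj₂ eq = k , sym eq

    only : ∀ {u} → Inc G (f b) u → Seen u → u ≡ at loc i
    only iu (j , refl) with j ≟ i
    ... | yes refl = refl
    ... | no  j≢i  = contradiction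
      (twice⁺ b D j≢i (hit (represents loc j) inj (inPalette (represents loc i) b∈Di) iu) b∈Di)
      (¬T-not once)

    from₁ : end₁ G (f b) ≢ at loc i
    from₁ eq = noLoop G (f b) (trans eq (sym
      (only (inj₂ refl) (reach-closed G closed (bridgeless (f b)) (i , sym eq)))))

    from₂ : end₂ G (f b) ≢ at loc i
    from₂ eq = noLoop G (f b) (trans
      (only (inj₁ refl) (reach-closed⁻ G closed (bridgeless (f b)) (i , sym eq))) (sym eq))

  -- Soundness of the search.

  module _ (bridgeless : Bridgeless G) where

    -- The induction follows the one branch of the search tree that `f` itself takes. Properness
    -- rules out a clash, `not-crowded` a crowded triple and `no-bridge` a bridge, which leaves the
    -- discrete leaf.
    handled-sound : ∀ es {pal p D} → T (handled es pal p D) →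
      Agrees pal p → InjectiveOn pal → Located pal D → Injective _≡_ _≡_ f
    visited-sound : ∀ ts es {pal p D} → T (visited ts es pal p D) →
      All (∃ ∘ Represents pal) ts → Agrees pal p → InjectiveOn pal → Located pal D →
      Injective _≡_ _≡_ f

    handled-sound [] {pal} {p} {D} h agr inj loc
      with T-∨⁻ {all (λ e → assigned p e e) (allFin 15)} h
    -- Every edge carries its own name, so the palette contains all edges and `inj` is injectivity
    -- of `f`.
    ... | inj₁ discrete = inj (used _) (used _)
      where
      used : ∀ e → e ∈ pal
      used e = proj₁ (agr e (assigned⁻ p
        (All.lookup (all⁺ (λ e → assigned p e e) (allFin 15) discrete) (∈-allFin e))))
    ... | inj₂ w with b , _ , hb ← find (any⁻ (bridge D) pal w) =
      contradiction hb (no-bridge bridgeless inj loc b)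
    handled-sound (e ∷ es) {pal} {p} {D} h agr inj loc
      with old , new ← T-∧⁻ {all (λ c → clash p e c ∨
             visited (triples (p [ e ]≔ just c) (ends e)) es pal (p [ e ]≔ just c) D) pal} h
      -- The branch depends on whether the colour `f e` already has a name.
      with any? (λ c → f c ≟ f e) pal
    ... | no ¬used = visited-sound _ es new (triples-represent agr′ (ends e)) agr′
            (fresh-injective inj ¬used) (fresh-located e loc)
      where
      agr′ : Agrees (e ∷ pal) (p [ e ]≔ just e)
      agr′ = assign p (fresh-agrees p e agr) (here refl) refl
    ... | yes used with c , c∈ , fc≡fe ← find used
                   with T-∨⁻ {clash p e c} (All.lookup (all⁺ _ pal old) c∈)
    ...   | inj₁ cl with x , e′ , ix , ix′ , eq , e≢e′ ← clash⁻ p e c cl =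
            contradiction (trans (sym fc≡fe) (proj₂ (agr e′ eq))) (proper e e′ x e≢e′ ix ix′)
    ...   | inj₂ v = visited-sound _ es v (triples-represent agr′ (ends e)) agr′ inj loc
      where
      agr′ : Agrees pal (p [ e ]≔ just c)
      agr′ = assign p agr c∈ fc≡fe

    visited-sound []       es h []             agr inj loc = handled-sound es h agr inj loc
    visited-sound (t ∷ ts) es {D = D} h ((v , r) ∷ rs) agr inj loc
      with all (apart t) D in eq
    -- Dropping `t` is safe, since `Located` does not claim that `D` is exhaustive.
    ... | false = visited-sound ts es h rs agr inj loc
    ... | true with loc′ ← locate inj loc r (subst T (sym eq) _)
                    with T-∨⁻ {any (λ c → twice c D) t} h
    ...   | inj₁ crowded = contradiction crowded (not-crowded loc′)
    ...   | inj₂ h′      = visited-sound ts es h′ rs agr inj loc′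

    -- With variables as arguments `handled` stays stuck while `≡ true` is turned into `T`, so the
    -- concrete search is not unfolded in this step.
    search-sound : ∀ es {pal p D} → handled es pal p D ≡ true →
      Agrees pal p → InjectiveOn pal → Located pal D → Injective _≡_ _≡_ f
    search-sound es h = handled-sound es (Equivalence.from T-≡ h)

    f-injective : Injective _≡_ _≡_ f
    f-injective = search-sound order {[]} {replicate 15 nothing} {[]} search
      -- Before any edge is coloured, all invariants hold vacuously.
      (λ e eq → contradiction (trans (sym (lookup-replicate e nothing)) eq) λ ())
      (λ ())
      (record { at = λ () ; represents = λ () ; at-injective = λ { {()} } })

  -- From injectivity to an isomorphism.

  module _ (connected : Connected G) (f-injective : Injective _≡_ _≡_ f) where

    g-injective : Injective _≡_ _≡_ g
    g-injective {x} {y} eq = star-injective x y (All.tabulate λ {e} e∈ →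
      let e′ , i , fe′≡fe = f-lift (subst (Inc G (f e)) eq (f-inc (∈-star⁻ e∈)))
      in ∈-star⁺ (subst (λ e → Inc Petersen e y) (f-injective fe′≡fe) i))

    ends-image : ∀ e {v} → Inc G (f e) v → v ≡ g (pEnd₁ e) ⊎ v ≡ g (pEnd₂ e)
    ends-image e i =
      two-ends G (f-inc (inj₁ refl)) (f-inc (inj₂ refl)) i (pNoLoop e ∘ g-injective)

    g-surjective : ∀ u → ∃[ x ] g x ≡ u
    g-surjective u = reach-closed G closed (connected (g zero) u) (zero , refl)
      where
      closed : ∀ {d u v} → _ → Inc G d u → Inc G d v → ∃[ x ] g x ≡ u → ∃[ x ] g x ≡ v
      closed _ iu iv (x , refl) with e , _ , refl ← f-lift iu =
        [ (λ eq → pEnd₁ e , sym eq) , (λ eq → pEnd₂ e , sym eq) ]′ (ends-image e iv)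

    f-surjective : ∀ d → ∃[ e ] f e ≡ d
    f-surjective d with x , eq ← g-surjective (end₁ G d)
                   with e , _ , fe≡d ← f-lift {x} (inj₁ (sym eq)) = e , fe≡d

    g⁻¹ : Fin (V G) → Vertex
    g⁻¹ = proj₁ ∘ g-surjective

    f⁻¹ : Fin (E G) → Edge
    f⁻¹ = proj₁ ∘ f-surjective

    g⁻¹-unique : ∀ {u x} → u ≡ g x → g⁻¹ u ≡ x
    g⁻¹-unique {u} eq = g-injective (trans (proj₂ (g-surjective u)) eq)

    -- The colouring maps the Petersen graph to `G`, so the isomorphism consists of the inverses of
    -- `g` and `f`.
    isomorphism : Iso G Petersen
    isomorphism = record
      { vmap = mk↔ₛ′ g⁻¹ g (λ x → g⁻¹-unique refl) (proj₂ ∘ g-surjective)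
      ; emap = mk↔ₛ′ f⁻¹ f (λ e → f-injective (proj₂ (f-surjective (f e)))) (proj₂ ∘ f-surjective)
      ; preserves = λ d → preserves (f⁻¹ d)
          (ends-image _ (inj₁ (cong (end₁ G) (proj₂ (f-surjective d)))))
          (ends-image _ (inj₂ (cong (end₂ G) (proj₂ (f-surjective d)))))
      }
      where
      preserves : ∀ {d} e →
        end₁ G d ≡ g (pEnd₁ e) ⊎ end₁ G d ≡ g (pEnd₂ e) →
        end₂ G d ≡ g (pEnd₁ e) ⊎ end₂ G d ≡ g (pEnd₂ e) →
        ((g⁻¹ (end₁ G d) ≡ pEnd₁ e) × (g⁻¹ (end₂ G d) ≡ pEnd₂ e)) ⊎
        ((g⁻¹ (end₁ G d) ≡ pEnd₂ e) × (g⁻¹ (end₂ G d) ≡ pEnd₁ e))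
      -- Two ends of `d` at the same vertex would make `d` a loop.
      preserves _ (inj₁ eq₁) (inj₁ eq₂) = contradiction (trans eq₁ (sym eq₂)) (noLoop G _)
      preserves _ (inj₂ eq₁) (inj₂ eq₂) = contradiction (trans eq₁ (sym eq₂)) (noLoop G _)
      preserves _ (inj₁ eq₁) (inj₂ eq₂) = inj₁ (g⁻¹-unique eq₁ , g⁻¹-unique eq₂)
      preserves _ (inj₂ eq₁) (inj₁ eq₂) = inj₂ (g⁻¹-unique eq₁ , g⁻¹-unique eq₂)

theorem1 : (G : Graph) → Cubic G → Connected G → Bridgeless G →
    HColorable G Petersen → Iso G Petersen
theorem1 G _ connected bridgeless (f , proper , local) =
  isomorphism connected (f-injective bridgeless)
  where
  open Colored G f (proj₁ ∘ local) proper
    (λ {x} {e} → proj₁ (proj₂ (local x)) e) (λ {x} {d} → proj₂ (proj₂ (local x)) d)
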